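{- For any integer $k \ge 4$, every oriented graph $G$ with $\delta^{\pm}_{*}(G) > \frac{1}{2}\left(k-1+\sqrt{k-3}\right)$ contains each antipath of length $k$ (as a subgraph).
   Context: An oriented graph is a loopless graph in which every edge is given an orientation, such that for any two vertices $u,v$ at most one of $uv$, $vu$ is an edge. For a vertex $v$, $d^+(v)$ (out-degree) is the number of vertices $w$ with $vw\in E(G)$ and $d^-(v)$ (in-degree) is the number of vertices $u$ with $uv \in E(G)$. The minimum pseudo-semidegree $\delta^{\pm}_{*}(G)$ is defined as follows: if $G$ has no edges then $\delta^{\pm}_{*}(G)=0$; otherwise $\delta^{\pm}_{*}(G)$ is the largest integer $d$ such that every vertex has out-degree either $0$ or at least $d$, and in-degree either $0$ or at least $d$. An antidirected path (antipath) is an orientation of a path such that every vertex of the path has in-degree $0$ or out-degree $0$ within the path; its length is its number of edges. (For even length there are two non-isomorphic antipaths; the claim is that all antipaths of length $k$ appear.) -}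

module Defs where

open import Data.Nat using (ℕ; zero; suc; _+_; _*_; _∸_; _≤_; _<_)
open import Data.Fin using (Fin; inject₁; toℕ) renaming (suc to fsuc)
open import Data.Bool using (Bool; true; false; if_then_else_)
open import Data.List using (List; map; allFin)
open import Data.Nat.ListAction using (sum)
open import Data.Product using (Σ; ∃; ∃-syntax; _×_)
open import Data.Sum using (_⊎_)
open import Relation.Binary.PropositionalEquality using (_≡_; _≢_)
open import Function.Definitions using (Injective)

record OrientedGraph (n : ℕ) : Set where
  field
    adj       : Fin n → Fin n → Bool
    loopless  : ∀ v → adj v v ≡ false
    oriented  : ∀ u v → adj u v ≡ true → adj v u ≡ false
open OrientedGraph public

countB : {n : ℕ} → (Fin n → Bool) → ℕ
countB {n} p = sum (map (λ w → if p w then 1 else 0) (allFin n))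

outdeg : {n : ℕ} → OrientedGraph n → Fin n → ℕ
outdeg G v = countB (λ w → adj G v w)

indeg : {n : ℕ} → OrientedGraph n → Fin n → ℕ
indeg G v = countB (λ u → adj G u v)

HasEdge : {n : ℕ} → OrientedGraph n → Set
HasEdge G = ∃[ u ] ∃[ v ] (adj G u v ≡ true)

PseudoSemidegreeCond : {n : ℕ} → OrientedGraph n → ℕ → Set
PseudoSemidegreeCond G d =
  ∀ v → (outdeg G v ≡ 0 ⊎ d ≤ outdeg G v) × (indeg G v ≡ 0 ⊎ d ≤ indeg G v)

-- δ±*(G) > b  (b a lower bound), unfolded from the definition:
-- if G has no edges, δ±*(G) = 0; otherwise δ±*(G) is the largest d
-- satisfying PseudoSemidegreeCond, which is downward closed, so
-- δ±*(G) ≥ d iff PseudoSemidegreeCond G d.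
-- Hence "δ±*(G) ≥ d" for d ≥ 1 is: G has an edge and the condition holds at d.
MinPseudoSemidegree≥ : {n : ℕ} → OrientedGraph n → ℕ → Set
MinPseudoSemidegree≥ G d = HasEdge G × PseudoSemidegreeCond G d

-- The real inequality  d > (k - 1 + √(k - 3)) / 2  for naturals d, k ≥ 3,
-- i.e.  2d - (k - 1) > √(k - 3),  i.e.  2d + 1 > k  and  (2d + 1 - k)² > k - 3.
AboveBound : ℕ → ℕ → Set
AboveBound k d = (k < 2 * d + 1) × (k ∸ 3 < (2 * d + 1 ∸ k) * (2 * d + 1 ∸ k))

-- An orientation of a path p₀ p₁ … p_k with k edges is described by
-- dir : Fin k → Bool, where dir i = true means edge pᵢ → pᵢ₊₁ and
-- dir i = false means pᵢ₊₁ → pᵢ.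
PathOrientation : ℕ → Set
PathOrientation k = Fin k → Bool

-- Antidirected: every vertex has in-degree 0 or out-degree 0 in the path.
-- Endpoints have degree 1, so this concerns inner vertices pᵢ₊₁ only,
-- which are sources/sinks iff the two incident edges i, i+1 have
-- different directions.
IsAntipath : {k : ℕ} → PathOrientation k → Set
IsAntipath {k} dir = ∀ (i j : Fin k) → toℕ j ≡ suc (toℕ i) → dir i ≢ dir j

EdgeIn : {n k : ℕ} → OrientedGraph n → PathOrientation k →
         (Fin (suc k) → Fin n) → Fin k → Set
EdgeIn G dir f i =
  if dir i then adj G (f (inject₁ i)) (f (fsuc i)) ≡ true
           else adj G (f (fsuc i)) (f (inject₁ i)) ≡ true

ContainsPath : {n k : ℕ} → OrientedGraph n → PathOrientation k → Set
ContainsPath {n} {k} G dir =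
  Σ (Fin (suc k) → Fin n) λ f → Injective _≡_ _≡_ f × (∀ i → EdgeIn G dir f i)

{-# OPTIONS --safe #-}
module Submission where

-- An antipath is grown two vertices at a time, arguing by contradiction.  Write d = t + c.
--
-- Odd antipaths y … w on 2t + 1 vertices, say between sinks, extend as soon as d > t: if the
-- ends are adjacent, one of them has in- and out-neighbours, hence more than 2t neighbours;
-- otherwise rotations at one end forbid neighbours of the other end, and the in-degrees of y
-- and w add up to at most 2t.
--
-- An antipath on 2t vertices that does not extend yields a near-cycle on 2t - 1 of its vertices:
-- an odd antipath from y to w, both sinks, together with the arc y → w.  Then y has at least
-- 2c + 2 ≥ 4 neighbours outside, and after reversing all arcs if necessary two of them are
-- in-neighbours.  Cut the near-cycle without y into t - 1 pairs a → b of consecutive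
-- vertices.  An outside in-neighbour of y sends arcs to both vertices of at least c pairs, an
-- outside out-neighbour receives arcs from both vertices of at least c pairs, and explicit
-- antipaths on 2t + 1 vertices show that these pairs are all distinct and never the last one.
-- Hence c (2c + 2) < t - 1, which is what the bound on d excludes.

open import Defs
open import Data.Nat using (ℕ; zero; suc; _+_; _*_; _∸_; _≤_; _<_; z≤n; s≤s)
open import Data.Nat.Properties
open import Data.Nat.ListAction using (sum)
open import Data.Nat.ListAction.Properties using (sum-↭)
open import Data.Nat.Tactic.RingSolver using (solve-∀)
open import Data.Bool using (Bool; true; false; not; _∧_; _∨_; if_then_else_)
open import Data.Bool.Properties using (not-involutive; ¬-not) renaming (_≟_ to _≟ᵇ_)
open import Data.Fin using (Fin; toℕ; inject≤) renaming (zero to fzero; suc to fsuc)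
import Data.Fin.Properties as Fin
open import Data.List using (List; []; _∷_; _++_; [_]; map; length; allFin; lookup)
open import Data.List.Properties using (++-assoc)
open import Data.List.Membership.Propositional using (_∈_; _∉_)
open import Data.List.Membership.Propositional.Properties using (∈-∃++; ∈-++⁺ˡ; ∈-allFin; ∈-lookup)
import Data.List.Membership.DecPropositional as DecMembership
open import Data.List.Relation.Unary.Any using (here; there)
open import Data.List.Relation.Unary.All as All using ([]; _∷_)
open import Data.List.Relation.Unary.All.Properties using (¬Any⇒All¬)
open import Data.List.Relation.Unary.AllPairs using ([]; _∷_)
open import Data.List.Relation.Unary.Unique.Propositional using (Unique)
open import Data.List.Relation.Unary.Unique.Propositional.Properties using (allFin⁺)
open import Data.List.Relation.Binary.Permutation.Propositional
  using (_↭_; ↭-refl; ↭-sym; ↭-trans; ↭-reflexive; prep; ↭⇒↭ₛ)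
open import Data.List.Relation.Binary.Permutation.Propositional.Properties
  using (∈-resp-↭; ↭-length; shift; ++⁺; ++-comm; map⁺; ++-commutativeMonoid)
import Data.List.Relation.Binary.Permutation.Setoid.Properties as Permutation
import Algebra.Solver.CommutativeMonoid as CommutativeMonoidSolver
open import Data.Product using (∃; ∃-syntax; _×_; _,_; proj₁; proj₂)
open import Data.Sum using (_⊎_; inj₁; inj₂)
open import Data.Empty using (⊥; ⊥-elim)
open import Function.Definitions using (Injective)
open import Relation.Nullary using (Dec; yes; no; does)
open import Relation.Nullary.Decidable using (decidable-stable; map′; _×-dec_; _→-dec_)
open import Relation.Binary.PropositionalEquality
  using (_≡_; _≢_; refl; sym; trans; cong; cong₂; subst; setoid)

private
  variable
    n m c d t : ℕ
    A B : Set
    xs ys : List A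
    r s : Bool

-- Finite sums and counting

⟦_⟧ : Bool → ℕ
⟦ b ⟧ = if b then 1 else 0

∑ : (A → ℕ) → List A → ℕ
∑ f xs = sum (map f xs)

⟦⟧≤1 : ∀ b → ⟦ b ⟧ ≤ 1
⟦⟧≤1 true  = ≤-refl
⟦⟧≤1 false = z≤n

⟦⟧-exclusive : ∀ p q → (p ≡ true → q ≡ true → ⊥) → ⟦ p ⟧ + ⟦ q ⟧ ≤ 1
⟦⟧-exclusive true  true  h = ⊥-elim (h refl refl)
⟦⟧-exclusive true  false h = ≤-refl
⟦⟧-exclusive false q     h = ⟦⟧≤1 q

∑-mono : (f g : A → ℕ) → (∀ x → f x ≤ g x) → ∀ xs → ∑ f xs ≤ ∑ g xs
∑-mono f g f≤g []       = z≤n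
∑-mono f g f≤g (x ∷ xs) = +-mono-≤ (f≤g x) (∑-mono f g f≤g xs)

∑-+ : (f g : A → ℕ) → ∀ xs → ∑ (λ x → f x + g x) xs ≡ ∑ f xs + ∑ g xs
∑-+ f g []       = refl
∑-+ f g (x ∷ xs) rewrite ∑-+ f g xs = interchange (f x) (g x) (∑ f xs) (∑ g xs)
  where
  interchange : ∀ a b c d → a + b + (c + d) ≡ a + c + (b + d)
  interchange = solve-∀

∑-0 : (xs : List A) → ∑ (λ _ → 0) xs ≡ 0
∑-0 []       = refl
∑-0 (x ∷ xs) = ∑-0 xs

∑-* : ∀ c (f : A → ℕ) xs → ∑ (λ x → c * f x) xs ≡ c * ∑ f xs
∑-* c f []       = sym (*-zeroʳ c)
∑-* c f (x ∷ xs) rewrite ∑-* c f xs = sym (*-distribˡ-+ c (f x) (∑ f xs))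

∑-swap : (f : A → B → ℕ) → ∀ xs ys →
  ∑ (λ x → ∑ (f x) ys) xs ≡ ∑ (λ y → ∑ (λ x → f x y) xs) ys
∑-swap f []       ys = sym (∑-0 ys)
∑-swap f (x ∷ xs) ys rewrite ∑-swap f xs ys =
  sym (∑-+ (f x) (λ y → ∑ (λ x → f x y) xs) ys)

∑-↭ : (f : A → ℕ) → xs ↭ ys → ∑ f xs ≡ ∑ f ys
∑-↭ f p = sum-↭ (map⁺ f p)

∈⇒≤∑ : (f : A → ℕ) → ∀ {x} → x ∈ xs → f x ≤ ∑ f xs
∈⇒≤∑ f (here refl) = m≤m+n _ _
∈⇒≤∑ f (there x∈)  = ≤-trans (∈⇒≤∑ f x∈) (m≤n+m _ _)

∑≤length : (f : A → ℕ) → (∀ {x} → x ∈ xs → f x ≤ 1) → ∑ f xs ≤ length xs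
∑≤length {xs = []}    f h = z≤n
∑≤length {xs = _ ∷ _} f h = +-mono-≤ (h (here refl)) (∑≤length f (λ p → h (there p)))

∑<length : (f : A → ℕ) → (∀ {x} → x ∈ xs → f x ≤ 1) →
  ∀ {x} → x ∈ xs → f x ≡ 0 → ∑ f xs < length xs
∑<length f h (here refl) fx≡0 rewrite fx≡0 = s≤s (∑≤length f (λ p → h (there p)))
∑<length {xs = y ∷ ys} f h (there x∈) fx≡0 = begin
  suc (f y + ∑ f ys) ≡⟨ +-suc (f y) _ ⟨
  f y + suc (∑ f ys) ≤⟨ +-mono-≤ (h (here refl)) (∑<length f (λ p → h (there p)) x∈ fx≡0) ⟩
  suc (length ys)    ∎
  where open ≤-Reasoning

-- Each nonzero term of `xs` uses up one occurrence in `ys`, which is then removed; later terms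
-- survive the removal because `xs` has no repetitions. This confines degree sums over all vertices
-- to the vertices of a path.
∑-cover : (f : A → ℕ) → Unique xs → (∀ x → f x ≡ 0 ⊎ x ∈ ys) → ∑ f xs ≤ ∑ f ys
∑-cover f u h = go u (λ {x} _ → h x)
  where
  go : Unique xs → (∀ {x} → x ∈ xs → f x ≡ 0 ⊎ x ∈ ys) → ∑ f xs ≤ ∑ f ys
  go [] h = z≤n
  go {xs = x ∷ xs} {ys = ys} (x∉ ∷ u) h with h (here refl)
  ... | inj₁ fx≡0 rewrite fx≡0 = go u (λ p → h (there p))
  ... | inj₂ x∈ys with ∈-∃++ x∈ys
  ... | ys₁ , ys₂ , refl = begin
    f x + ∑ f xs           ≤⟨ +-monoʳ-≤ (f x) (go u rest) ⟩
    f x + ∑ f (ys₁ ++ ys₂) ≡⟨ ∑-↭ f (shift x ys₁ ys₂) ⟨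
    ∑ f ys                 ∎
    where
    open ≤-Reasoning
    rest : ∀ {z} → z ∈ xs → f z ≡ 0 ⊎ z ∈ ys₁ ++ ys₂
    rest z∈ with h (there z∈)
    ... | inj₁ fz≡0 = inj₁ fz≡0
    ... | inj₂ z∈ys with ∈-resp-↭ (shift x ys₁ ys₂) z∈ys
    ... | here refl = ⊥-elim (All.lookup x∉ z∈ refl)
    ... | there z∈′ = inj₂ z∈′

∑⟦⟧≡0 : (p : A → Bool) → (∀ x → p x ≡ true → ⊥) → ∀ xs → ∑ (λ x → ⟦ p x ⟧) xs ≡ 0
∑⟦⟧≡0 p h []       = refl
∑⟦⟧≡0 p h (x ∷ xs) with p x in eq
... | true  = ⊥-elim (h x eq)
... | false = ∑⟦⟧≡0 p h xs

∑⟦⟧≤1 : (p : A → Bool) → Unique xs →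
  (∀ x y → x ≢ y → p x ≡ true → p y ≡ true → ⊥) → ∑ (λ x → ⟦ p x ⟧) xs ≤ 1
∑⟦⟧≤1 p []                 h = z≤n
∑⟦⟧≤1 {xs = x ∷ xs} p (x∉ ∷ u) h with p x in eq
... | false = ∑⟦⟧≤1 p u h
... | true  = s≤s (≤-trans (≤-reflexive (none x∉)) z≤n)
  where
  none : ∀ {zs} → All.All (x ≢_) zs → ∑ (λ x → ⟦ p x ⟧) zs ≡ 0
  none []                   = refl
  none {z ∷ zs} (x≢z ∷ x∉) with p z in eq′
  ... | true  = ⊥-elim (h x z x≢z eq eq′)
  ... | false = none x∉

-- Duplicate-free lists

Unique-resp-↭ : {xs ys : List A} → xs ↭ ys → Unique xs → Unique ys
Unique-resp-↭ {A = A} p = Permutation.Unique-resp-↭ (setoid A) (↭⇒↭ₛ p)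

Unique-∷ : ∀ {x : A} → x ∉ xs → Unique xs → Unique (x ∷ xs)
Unique-∷ x∉ u = ¬Any⇒All¬ _ x∉ ∷ u

∉-∷ : ∀ {x y : A} → x ≢ y → x ∉ xs → x ∉ y ∷ xs
∉-∷ x≢y x∉ (here eq)  = x≢y eq
∉-∷ x≢y x∉ (there x∈) = x∉ x∈

-- Alternating walks

op : OrientedGraph n → OrientedGraph n
op G = record
  { adj      = λ u v → adj G v u
  ; loopless = loopless G
  ; oriented = λ u v → oriented G v u
  }

adj⇒≢ : (G : OrientedGraph n) → ∀ {u v} → adj G u v ≡ true → u ≢ v
adj⇒≢ G {u} e refl with trans (sym e) (loopless G u)
... | ()

adj-asym : (G : OrientedGraph n) → ∀ {u v} → adj G u v ≡ true → adj G v u ≡ true → ⊥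
adj-asym G {u} {v} e e′ with trans (sym e′) (oriented G u v e)
... | ()

-- A vertex carries the sign true if it is a source of the walk and false if it is a sink.
Arc : OrientedGraph n → Bool → Fin n → Fin n → Set
Arc G true  u v = adj G u v ≡ true
Arc G false u v = adj G v u ≡ true

data Walk (G : OrientedGraph n) : Bool → Fin n → Bool → Fin n → List (Fin n) → Set where
  end  : ∀ {v} → Walk G s v s v [ v ]
  step : ∀ {u v w l} → Arc G s u v → Walk G (not s) v r w l → Walk G s u r w (u ∷ l)

-- A walk whose vertices are known up to reordering, so that reversal keeps the vertex list.
Path : OrientedGraph n → Bool → Fin n → Bool → Fin n → List (Fin n) → Set
Path G s v r w L = ∃[ l ] Walk G s v r w l × l ↭ L

module _ {G : OrientedGraph n} where

  arc-sym : ∀ s {u v} → Arc G s u v → Arc G (not s) v u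
  arc-sym true  e = e
  arc-sym false e = e

  ⌊_⌋ : ∀ {s v r w l} → Walk G s v r w l → Path G s v r w l
  ⌊ W ⌋ = _ , W , ↭-refl

  infixr 5 _◂_ _◂⟨_⟩_

  _◂_ : ∀ {s u v r w L} → Arc G s u v → Path G (not s) v r w L → Path G s u r w (u ∷ L)
  e ◂ (l , W , p) = _ , step e W , prep _ p

  -- The sign of the second path enters through an equation because `not (not s)`, which arises when
  -- a walk is reversed, does not reduce for a variable `s`.
  _◂⟨_⟩_ : ∀ {s v r w s′ v′ r′ w′ L L′} → Path G s v r w L → Arc G r w v′ →
    Path G s′ v′ r′ w′ L′ → {s′≡ : s′ ≡ not r} → Path G s v r′ w′ (L ++ L′)
  _◂⟨_⟩_ (l , W , p) e (l′ , W′ , p′) {refl} = _ , append W e W′ , ++⁺ p p′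
    where
    append : ∀ {s v r w v′ r′ w′ l l′} → Walk G s v r w l → Arc G r w v′ →
      Walk G (not r) v′ r′ w′ l′ → Walk G s v r′ w′ (l ++ l′)
    append end        e W′ = step e W′
    append (step f W) e W′ = step f (append W e W′)

  permute : ∀ {s v r w L L′} → L ↭ L′ → Path G s v r w L → Path G s v r w L′
  permute q (l , W , p) = l , W , ↭-trans p q

  private
    rev-walk : ∀ {s v r w l} → Walk G s v r w l → Path G r w s v l
    rev-walk end = ⌊ end ⌋
    rev-walk {s} (step {u = u} {l = l} e W) =
      permute (++-comm l [ u ])
        (_◂⟨_⟩_ (rev-walk W) (arc-sym s e) ⌊ end {s = s} ⌋ {sym (not-involutive s)})

  rev : ∀ {s v r w L} → Path G s v r w L → Path G r w s v L
  rev (l , W , p) = permute p (rev-walk W)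

module _ {G : OrientedGraph n} where

  infixr 5 _◂⁺_ _◂⁻_ _⁺◂⟨_⟩_ _⁻◂⟨_⟩_

  _◂⁺_ : ∀ {u v r w L} → adj G u v ≡ true → Path G false v r w L → Path G true u r w (u ∷ L)
  _◂⁺_ = _◂_ {s = true}

  _◂⁻_ : ∀ {u v r w L} → adj G v u ≡ true → Path G true v r w L → Path G false u r w (u ∷ L)
  _◂⁻_ = _◂_ {s = false}

  _⁺◂⟨_⟩_ : ∀ {s v w v′ r w′ L L′} → Path G s v true w L → adj G w v′ ≡ true →
    Path G false v′ r w′ L′ → Path G s v r w′ (L ++ L′)
  P ⁺◂⟨ e ⟩ Q = _◂⟨_⟩_ P e Q {refl}

  _⁻◂⟨_⟩_ : ∀ {s v w v′ r w′ L L′} → Path G s v false w L → adj G v′ w ≡ true →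
    Path G true v′ r w′ L′ → Path G s v r w′ (L ++ L′)
  P ⁻◂⟨ e ⟩ Q = _◂⟨_⟩_ P e Q {refl}

op-path : {G : OrientedGraph n} → ∀ {s v r w L} →
  Path G s v r w L → Path (op G) (not s) v (not r) w L
op-path {G = G} (l , W , p) = l , go W , p
  where
  op-arc : ∀ s {u v} → Arc G s u v → Arc (op G) (not s) u v
  op-arc true  e = e
  op-arc false e = e
  go : ∀ {s v r w l} → Walk G s v r w l → Walk (op G) (not s) v (not r) w l
  go end                = end
  go (step {s = s} e W) = step (op-arc s e) (go W)

-- Sink-to-sink walks as lists of (source, sink) pairs

flat : List (A × A) → List A
flat []             = []
flat ((a , b) ∷ ps) = a ∷ b ∷ flat ps

length-flat : (ps : List (A × A)) → length (flat ps) ≡ 2 * length ps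
length-flat []       = refl
length-flat (p ∷ ps) = trans (cong (λ k → 2 + k) (length-flat ps)) (sym (*-suc 2 (length ps)))

∑-flat : (f : A → ℕ) → ∀ ps → ∑ f (flat ps) ≡ ∑ (λ (a , b) → f a + f b) ps
∑-flat f []             = refl
∑-flat f ((a , b) ∷ ps) = trans (cong (λ k → f a + (f b + k)) (∑-flat f ps))
                                (sym (+-assoc (f a) (f b) _))

-- The initial sink `y` is kept out of the list, so the walk has vertices `y ∷ flat ps` and every
-- pair follows a sink.
data Zigzag (G : OrientedGraph n) : Fin n → Fin n → List (Fin n × Fin n) → Set where
  done : ∀ {y} → Zigzag G y y []
  zig  : ∀ {y a b w ps} → adj G a y ≡ true → adj G a b ≡ true →
         Zigzag G b w ps → Zigzag G y w ((a , b) ∷ ps)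

module _ {G : OrientedGraph n} where

  toZigzag : ∀ {y w l} → Walk G false y false w l → ∃[ ps ] Zigzag G y w ps × l ≡ y ∷ flat ps
  toZigzag end = [] , done , refl
  toZigzag (step e (step f W)) with toZigzag W
  ... | ps , Z , refl = _ , zig e f Z , refl

  fromZigzag : ∀ {y w ps} → Zigzag G y w ps → Path G false y false w (y ∷ flat ps)
  fromZigzag done        = ⌊ end ⌋
  fromZigzag (zig e f Z) = e ◂⁻ f ◂⁺ fromZigzag Z

  last-pair : ∀ {a b w ps} → adj G a b ≡ true → Zigzag G b w ps →
    ∃[ a′ ] (a′ , w) ∈ (a , b) ∷ ps × adj G a′ w ≡ true
  last-pair e done = _ , here refl , e
  last-pair e (zig _ f Z) with last-pair f Z
  ... | a′ , p , g = a′ , there p , g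

-- Extending odd paths

-- The ends of an even path have opposite signs, so reading it from its source end loses nothing.
-- The ends of an odd path have equal signs, and `NoOddPath` excludes both.
NoEvenPath : OrientedGraph n → ℕ → Set
NoEvenPath G m = ∀ {v w L} → Path G true v false w L → Unique L → length L ≡ m → ⊥

NoOddPath : OrientedGraph n → ℕ → Set
NoOddPath G m = ∀ {s v w L} → Path G s v s w L → Unique L → length L ≡ m → ⊥

NoOddPath-op : {G : OrientedGraph n} → NoOddPath G m → NoOddPath (op G) m
NoOddPath-op h P = h (op-path P)

NoEvenPath-op : {G : OrientedGraph n} → NoEvenPath G m → NoEvenPath (op G) m
NoEvenPath-op h P = h (rev (op-path P))

Condition-op : {G : OrientedGraph n} → PseudoSemidegreeCond G d → PseudoSemidegreeCond (op G) d
Condition-op h v = proj₂ (h v) , proj₁ (h v)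

-- The degree condition bounds the out-degree from below only once it is known to be nonzero; the
-- given arc witnesses that.
≤outdeg : (G : OrientedGraph n) → PseudoSemidegreeCond G d →
  ∀ {u v} → adj G u v ≡ true → d ≤ outdeg G u
≤outdeg G cond {u} {v} e with proj₁ (cond u)
... | inj₂ d≤ = d≤
... | inj₁ eq = ⊥-elim (1+n≰n (begin
  1                  ≡⟨ cong ⟦_⟧ e ⟨
  ⟦ adj G u v ⟧      ≤⟨ ∈⇒≤∑ (λ w → ⟦ adj G u w ⟧) (∈-allFin v) ⟩
  outdeg G u         ≡⟨ eq ⟩
  0                  ∎))
  where open ≤-Reasoning

≤indeg : (G : OrientedGraph n) → PseudoSemidegreeCond G d →
  ∀ {u v} → adj G u v ≡ true → d ≤ indeg G v
≤indeg G cond = ≤outdeg (op G) (Condition-op {G = G} cond)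

outdeg-inside : (G : OrientedGraph n) → ∀ {v L} → (∀ w → adj G v w ≡ true → w ∈ L) →
  outdeg G v ≤ ∑ (λ w → ⟦ adj G v w ⟧) L
outdeg-inside G {v} {L} inside = ∑-cover (λ w → ⟦ adj G v w ⟧) (allFin⁺ _) cases
  where
  cases : ∀ w → ⟦ adj G v w ⟧ ≡ 0 ⊎ w ∈ L
  cases w with adj G v w in eq
  ... | true  = inj₂ (inside w eq)
  ... | false = inj₁ refl

infix 4 _∈?_
_∈?_ : (v : Fin n) (L : List (Fin n)) → Dec (v ∈ L)
_∈?_ = DecMembership._∈?_ Fin._≟_

∈-stable : ∀ {v : Fin n} {L} → (v ∉ L → ⊥) → v ∈ L
∈-stable {v = v} {L} h with v ∈? L
... | yes v∈ = v∈
... | no v∉  = ⊥-elim (h v∉)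

-- No vertex is both an in- and an out-neighbour of `v`, and strictness comes from `v` itself, which
-- contributes 0.
neighbours<length : (G : OrientedGraph n) → ∀ {v L} → v ∈ L →
  ∑ (λ u → ⟦ adj G u v ⟧ + ⟦ adj G v u ⟧) L < length L
neighbours<length G {v} v∈ = ∑<length _
  (λ {u} _ → ⟦⟧-exclusive (adj G u v) (adj G v u) (adj-asym G)) v∈
  (cong (λ b → ⟦ b ⟧ + ⟦ b ⟧) (loopless G v))

first∈ : {G : OrientedGraph n} → ∀ {s v r w L} → Path G s v r w L → v ∈ L
first∈ (_ , end      , p) = ∈-resp-↭ p (here refl)
first∈ (_ , step _ _ , p) = ∈-resp-↭ p (here refl)

-- p has both in- and out-neighbours, and those outside the path would extend it: the
-- out-neighbours because the arc p → q closes the path up at p.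
adjacent-ends : (G : OrientedGraph n) → PseudoSemidegreeCond G d → ∀ {p q L} →
  Path G false p false q L → adj G p q ≡ true → Unique L →
  NoEvenPath G (suc (length L)) → 2 * d < length L
adjacent-ends G cond (_ , end , _) pq u none = ⊥-elim (adj⇒≢ G pq refl)
adjacent-ends {d = d} G cond {p} {q} {L} P@(_ , step {v = a} {l = l} ap W , perm) pq u none =
  begin-strict
  2 * d                                         ≡⟨ cong (d +_) (+-identityʳ d) ⟩
  d + d                                         ≤⟨ +-mono-≤ (≤indeg G cond ap) (≤outdeg G cond pq) ⟩
  indeg G p + outdeg G p                        ≤⟨ +-mono-≤ (outdeg-inside (op G) in-closed)
                                                            (outdeg-inside G out-closed) ⟩
  ∑ (λ v → ⟦ adj G v p ⟧) L + ∑ (λ v → ⟦ adj G p v ⟧) L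
                                                ≡⟨ ∑-+ (λ v → ⟦ adj G v p ⟧) _ L ⟨
  ∑ (λ v → ⟦ adj G v p ⟧ + ⟦ adj G p v ⟧) L     <⟨ neighbours<length G (first∈ P) ⟩
  length L                                      ∎
  where
  open ≤-Reasoning
  in-closed : ∀ v → adj G v p ≡ true → v ∈ L
  in-closed v vp = ∈-stable λ v∉ → none (vp ◂⁺ P) (Unique-∷ v∉ u) refl
  out-closed : ∀ v → adj G p v ≡ true → v ∈ L
  out-closed v pv = ∈-stable λ v∉ → none
    (permute (prep v perm) (rev (pv ◂⁻ pq ◂⁺ rev ⌊ W ⌋))) (Unique-∷ v∉ u) refl

-- All in-neighbours of both ends lie on the path, since any other would extend it. Walking along
-- the pairs, the possible arcs into `w` and into `y` are matched so that two matched arcs would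
-- give a path on the same vertices with adjacent ends, which `adjacent-ends` rules out. So the two
-- in-degrees add up to at most `2 * t`, less than `2 * d`.
no-odd-sinks : (G : OrientedGraph n) → PseudoSemidegreeCond G d → 1 ≤ t → t < d →
  NoEvenPath G (2 + 2 * t) →
  ∀ {y w L} → Path G false y false w L → Unique L → length L ≡ suc (2 * t) → ⊥
no-odd-sinks {d = d} {t = t} G cond 1≤t t<d none {y} {w} {L} (l , W , perm) u len
  with toZigzag W
... | ps , Z , refl = <-irrefl refl (begin-strict
  2 * t                                                 <⟨ *-monoʳ-< 2 t<d ⟩
  2 * d                                                 ≡⟨ cong (d +_) (+-identityʳ d) ⟩
  d + d                                                 ≤⟨ degrees Z length-ps ⟩
  indeg G w + indeg G y                                 ≤⟨ +-mono-≤ (outdeg-inside (op G) w-closed)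
                                                                    (outdeg-inside (op G) y-closed) ⟩
  ∑ (λ v → ⟦ adj G v w ⟧) L + ∑ (λ v → ⟦ adj G v y ⟧) L ≡⟨ ∑-+ (λ v → ⟦ adj G v w ⟧) _ L ⟨
  ∑ f L                                                 ≡⟨ ∑-↭ f perm ⟨
  (⟦ adj G y w ⟧ + ⟦ adj G y y ⟧) + ∑ f (flat ps)       ≡⟨ cong₂ _+_
                                                            (trans (cong (λ b → ⟦ adj G y w ⟧ + ⟦ b ⟧) (loopless G y))
                                                                   (+-identityʳ _))
                                                            (∑-flat f ps) ⟩
  ⟦ adj G y w ⟧ + ∑ F ps                                ≤⟨ bound ⌊ end ⌋ Z (↭-sym perm) ⟩
  2 * length ps                                         ≡⟨ cong (2 *_) length-ps ⟩
  2 * t                                                 ∎)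
  where
  open ≤-Reasoning
  f : Fin _ → ℕ
  f v = ⟦ adj G v w ⟧ + ⟦ adj G v y ⟧
  F : Fin _ × Fin _ → ℕ
  F (a , b) = f a + f b
  length-ps : length ps ≡ t
  length-ps = *-cancelˡ-≡ _ _ 2
    (suc-injective (trans (cong suc (sym (length-flat ps))) (trans (↭-length perm) len)))
  P : Path G false y false w L
  P = l , W , perm
  none′ : NoEvenPath G (suc (length L))
  none′ Q v e = none Q v (trans e (cong suc len))
  w-closed : ∀ v → adj G v w ≡ true → v ∈ L
  w-closed v vw = ∈-stable λ v∉ → none′ (vw ◂⁺ rev P) (Unique-∷ v∉ u) refl
  y-closed : ∀ v → adj G v y ≡ true → v ∈ L
  y-closed v vy = ∈-stable λ v∉ → none′ (vy ◂⁺ P) (Unique-∷ v∉ u) refl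
  degrees : ∀ {ps} → Zigzag G y w ps → length ps ≡ t → d + d ≤ indeg G w + indeg G y
  -- Since `t` is positive, the path has a pair, so both ends have an in-neighbour on it.
  degrees done refl = ⊥-elim (1+n≰n 1≤t)
  degrees (zig ay ab Z) _ =
    +-mono-≤ (≤indeg G cond (proj₂ (proj₂ (last-pair ab Z)))) (≤indeg G cond ay)
  not-adjacent : ∀ {p q L′} → Path G false p false q L′ → L ↭ L′ → adj G p q ≡ true → ⊥
  not-adjacent Q σ pq = <-irrefl refl (begin-strict
    2 * d     <⟨ adjacent-ends G cond (permute (↭-sym σ) Q) pq u none′ ⟩
    length L  ≡⟨ len ⟩
    1 + 2 * t <⟨ n<1+n _ ⟩
    2 + 2 * t ≡⟨ *-suc 2 t ⟨
    2 * suc t ≤⟨ *-monoʳ-≤ 2 t<d ⟩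
    2 * d     ∎)
  regroup : ∀ p q r s u v → p + (((q + r) + (s + u)) + v) ≡ (p + r) + ((q + u) + (s + v))
  regroup = solve-∀
  double-suc : ∀ k → 1 + (1 + 2 * k) ≡ 2 * suc k
  double-suc = solve-∀
  -- If a → y, then the sink b before a is an end of a path with the same vertices and
  -- other end w; if a → w, then the sink b′ after a is one with other end y.
  bound : ∀ {b l₁ qs} → Path G false y false b l₁ → Zigzag G b w qs → L ↭ l₁ ++ flat qs →
    ⟦ adj G b w ⟧ + ∑ F qs ≤ 2 * length qs
  bound Q done σ rewrite loopless G w = z≤n
  bound {b} {l₁} Q (zig {a = a} {b = b′} {ps = qs} ab ab′ Z) σ = begin
    ⟦ adj G b w ⟧ + (F (a , b′) + ∑ F qs)
      ≡⟨ regroup ⟦ adj G b w ⟧ ⟦ adj G a w ⟧ ⟦ adj G a y ⟧ ⟦ adj G b′ w ⟧ ⟦ adj G b′ y ⟧ (∑ F qs) ⟩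
    (⟦ adj G b w ⟧ + ⟦ adj G a y ⟧) +
      ((⟦ adj G a w ⟧ + ⟦ adj G b′ y ⟧) + (⟦ adj G b′ w ⟧ + ∑ F qs))
      ≤⟨ +-mono-≤ (⟦⟧-exclusive (adj G b w) (adj G a y) λ bw ay →
                     not-adjacent (rev Q ⁻◂⟨ ay ⟩ ab′ ◂⁺ fromZigzag Z) σ bw)
        (+-mono-≤ (⟦⟧-exclusive (adj G a w) (adj G b′ y) λ aw b′y →
                     not-adjacent (fromZigzag Z ⁻◂⟨ aw ⟩ ab ◂⁺ rev Q)
                       (↭-trans σ (↭-trans (shift a l₁ (b′ ∷ flat qs))
                         (↭-trans (prep a (++-comm l₁ (b′ ∷ flat qs)))
                                  (↭-sym (shift a (b′ ∷ flat qs) l₁))))) b′y)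
                  (bound (Q ⁻◂⟨ ab ⟩ ab′ ◂⁺ ⌊ end ⌋) Z
                    (↭-trans σ (↭-reflexive (sym (++-assoc l₁ (a ∷ b′ ∷ []) (flat qs))))))) ⟩
    1 + (1 + 2 * length qs)
      ≡⟨ double-suc (length qs) ⟩
    2 * suc (length qs) ∎

no-odd-path : (G : OrientedGraph n) → PseudoSemidegreeCond G d → 1 ≤ t → t < d →
  NoEvenPath G (2 + 2 * t) → NoOddPath G (suc (2 * t))
no-odd-path G cond 1≤t t<d none {false} P = no-odd-sinks G cond 1≤t t<d none P
no-odd-path G cond 1≤t t<d none {true}  P =
  no-odd-sinks (op G) (Condition-op {G = G} cond) 1≤t t<d (NoEvenPath-op {G = G} none) (op-path P)

-- Near-cycles: an odd path between sinks y and w together with the arc y → w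

NoNearCycle : OrientedGraph n → ℕ → Set
NoNearCycle G m = ∀ {y w L} → Path G false y false w L → adj G y w ≡ true →
  Unique L → length L ≡ m → ⊥

module Rearrange {A : Set} where
  open CommutativeMonoidSolver (++-commutativeMonoid {A = A}) public
    using (solve; _⊜_; _⊕_)

-- On an even path from v to w, in- and out-degree force two pairs (a , b), (a′ , b′) that are
-- consecutive on the path, with a → w and v → a′, or with b → w and v → b′.
no-even-path : (G : OrientedGraph n) → PseudoSemidegreeCond G d → suc t < d →
  NoOddPath G (3 + 2 * t) → NoNearCycle G (suc (2 * t)) → NoEvenPath G (2 * suc t)
no-even-path {d = d} {t = t} G cond t<d none noNC {v} {w} {L}
  (_ , step {v = b₁} vb W , perm) u len with toZigzag W
... | ps , Z , refl = <-irrefl refl (begin-strict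
  2 * suc t                                             <⟨ *-monoʳ-< 2 t<d ⟩
  2 * d                                                 ≡⟨ cong (d +_) (+-identityʳ d) ⟩
  d + d                                                 ≤⟨ +-mono-≤ (≤indeg G cond (proj₂ (proj₂ (last-pair vb Z))))
                                                                    (≤outdeg G cond vb) ⟩
  indeg G w + outdeg G v                                ≤⟨ +-mono-≤ (outdeg-inside (op G) w-closed)
                                                                    (outdeg-inside G v-closed) ⟩
  ∑ (λ u → ⟦ adj G u w ⟧) L + ∑ (λ u → ⟦ adj G v u ⟧) L ≡⟨ ∑-+ (λ u → ⟦ adj G u w ⟧) _ L ⟨
  ∑ f L                                                 ≡⟨ ∑-↭ f perm ⟨
  f v + (f b₁ + ∑ f (flat ps))                          ≡⟨ cong (λ k → f v + (f b₁ + k)) (∑-flat f ps) ⟩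
  f v + (f b₁ + ∑ F ps)                                 ≡⟨ regroup ⟦ adj G v w ⟧ ⟦ adj G v v ⟧
                                                             ⟦ adj G b₁ w ⟧ ⟦ adj G v b₁ ⟧ (∑ F ps) ⟩
  (⟦ adj G v v ⟧ + ⟦ adj G v b₁ ⟧) +
    ((⟦ adj G v w ⟧ + ⟦ adj G b₁ w ⟧) + ∑ F ps)         ≤⟨ +-mono-≤
                                                             (⟦⟧-exclusive (adj G v v) (adj G v b₁)
                                                               λ vv _ → adj⇒≢ G vv refl)
                                                             (bound ⌊ end ⌋ vb Z (↭-sym perm)) ⟩
  2 + 2 * length ps                                     ≡⟨ cong (2 +_) (length-flat ps) ⟨
  length (v ∷ b₁ ∷ flat ps)                             ≡⟨ ↭-length perm ⟩
  length L                                              ≡⟨ len ⟩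
  2 * suc t                                             ∎)
  where
  open ≤-Reasoning
  f : Fin _ → ℕ
  f u = ⟦ adj G u w ⟧ + ⟦ adj G v u ⟧
  F : Fin _ × Fin _ → ℕ
  F (a , b) = f a + f b
  P : Path G true v false w L
  P = _ , step vb W , perm
  len′ : suc (length L) ≡ 3 + 2 * t
  len′ = cong suc (trans len (*-suc 2 t))
  w-closed : ∀ u → adj G u w ≡ true → u ∈ L
  w-closed _ uw = ∈-stable λ u∉ → none (uw ◂⁺ rev P) (Unique-∷ u∉ u) len′
  v-closed : ∀ u → adj G v u ≡ true → u ∈ L
  v-closed _ vu = ∈-stable λ u∉ → none (vu ◂⁻ P) (Unique-∷ u∉ u) len′
  regroup : ∀ p q r s k → (p + q) + ((r + s) + k) ≡ (q + s) + ((p + r) + k)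
  regroup = solve-∀
  regroup′ : ∀ p q r s k l R → (p + q) + (((r + s) + (k + l)) + R) ≡ (p + s) + ((q + l) + ((r + k) + R))
  regroup′ = solve-∀
  double-suc : ∀ k → 1 + (1 + suc (2 * k)) ≡ suc (2 * suc k)
  double-suc = solve-∀
  near-cycle : ∀ {y z x K} → Path G false y false z K → adj G y z ≡ true → L ↭ x ∷ K → ⊥
  near-cycle Q yz σ with Unique-resp-↭ σ u
  ... | _ ∷ uK = noNC Q yz uK
    (suc-injective (trans (sym (↭-length σ)) (trans len (*-suc 2 t))))
  -- The count is shifted by one pair: arcs into `w` from `(a , b)` are matched with arcs from `v`
  -- to the next pair. At the end only a possible arc `a → w` is left over, hence the `suc`.
  bound : ∀ {a b l₁ qs} → Path G true v true a l₁ → adj G a b ≡ true → Zigzag G b w qs →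
    L ↭ l₁ ++ b ∷ flat qs →
    (⟦ adj G a w ⟧ + ⟦ adj G b w ⟧) + ∑ F qs ≤ suc (2 * length qs)
  bound {a} Q ab done σ rewrite loopless G w | +-identityʳ ⟦ adj G a w ⟧ | +-identityʳ ⟦ adj G a w ⟧ =
    ⟦⟧≤1 (adj G a w)
  bound {a} {b} {l₁} Q ab (zig {a = a′} {b = b′} {ps = qs} a′b a′b′ Z) σ = begin
    (⟦ adj G a w ⟧ + ⟦ adj G b w ⟧) + (F (a′ , b′) + ∑ F qs)
      ≡⟨ regroup′ ⟦ adj G a w ⟧ ⟦ adj G b w ⟧ ⟦ adj G a′ w ⟧ ⟦ adj G v a′ ⟧
                  ⟦ adj G b′ w ⟧ ⟦ adj G v b′ ⟧ (∑ F qs) ⟩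
    (⟦ adj G a w ⟧ + ⟦ adj G v a′ ⟧) + ((⟦ adj G b w ⟧ + ⟦ adj G v b′ ⟧) +
      ((⟦ adj G a′ w ⟧ + ⟦ adj G b′ w ⟧) + ∑ F qs))
      -- Either coincidence gives a near-cycle on all vertices but one: `a′ ← v … a → w … b′` with
      -- the arc `a′ → b′` misses `b`, and `b ← a … v → b′ … w` with the arc `b → w` misses `a′`.
      ≤⟨ +-mono-≤ (⟦⟧-exclusive (adj G a w) (adj G v a′) λ aw va′ →
                     near-cycle (va′ ◂⁻ Q ⁺◂⟨ aw ⟩ rev (fromZigzag Z)) a′b′
                       (↭-trans σ (σ₁ l₁ (flat qs))))
        (+-mono-≤ (⟦⟧-exclusive (adj G b w) (adj G v b′) λ bw vb′ →
                     near-cycle (ab ◂⁻ rev Q ⁺◂⟨ vb′ ⟩ fromZigzag Z) bw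
                       (↭-trans σ (σ₂ l₁ (flat qs))))
                  (bound (Q ⁺◂⟨ ab ⟩ a′b ◂⁻ ⌊ end ⌋) a′b′ Z
                    (↭-trans σ (↭-reflexive (sym (++-assoc l₁ (b ∷ a′ ∷ []) (b′ ∷ flat qs))))))) ⟩
    1 + (1 + suc (2 * length qs))
      ≡⟨ double-suc (length qs) ⟩
    suc (2 * suc (length qs)) ∎
    where
    open Rearrange {Fin _}
    σ₁ : ∀ l k → l ++ b ∷ a′ ∷ b′ ∷ k ↭ b ∷ a′ ∷ l ++ b′ ∷ k
    σ₁ l k = solve 5 (λ l b a′ b′ k → l ⊕ (b ⊕ (a′ ⊕ (b′ ⊕ k))) ⊜ b ⊕ (a′ ⊕ (l ⊕ (b′ ⊕ k))))
      ↭-refl l [ b ] [ a′ ] [ b′ ] k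
    σ₂ : ∀ l k → l ++ b ∷ a′ ∷ b′ ∷ k ↭ a′ ∷ b ∷ l ++ b′ ∷ k
    σ₂ l k = solve 5 (λ l b a′ b′ k → l ⊕ (b ⊕ (a′ ⊕ (b′ ⊕ k))) ⊜ a′ ⊕ (b ⊕ (l ⊕ (b′ ⊕ k))))
      ↭-refl l [ b ] [ a′ ] [ b′ ] k

-- Cutting near-cycles at a pair and rerouting them through outside vertices

-- A pair (a , b) on a path from y to w, which continues b′ ← a → b around the pair
record Split (G : OrientedGraph n) (y w a b : Fin n) (L : List (Fin n)) : Set where
  field
    {b′}    : Fin n
    {l₁ l₂} : List (Fin n)
    before  : Path G false y false b′ l₁
    back    : adj G a b′ ≡ true
    forth   : adj G a b ≡ true
    after   : Path G false b false w l₂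
    parts   : L ↭ l₁ ++ a ∷ l₂

module _ {G : OrientedGraph n} where

  split-at : ∀ {y x w l ps L} → Path G false y false x l → Zigzag G x w ps → L ↭ l ++ flat ps →
    ∀ {a b} → (a , b) ∈ ps → Split G y w a b L
  split-at Q (zig ax ab Z) σ (here refl) = record
    { before = Q ; back = ax ; forth = ab ; after = fromZigzag Z ; parts = σ }
  split-at {l = l} Q (zig {a = a} {b = b} {ps = ps} ax ab Z) σ (there p) =
    split-at (Q ⁻◂⟨ ax ⟩ ab ◂⁺ ⌊ end ⌋) Z
      (↭-trans σ (↭-reflexive (sym (++-assoc l (a ∷ b ∷ []) (flat ps))))) p

  -- y → w closes the path up, so that it can be cut open anywhere.
  op-near-cycle : ∀ {y w L} → Path G false y false w L → adj G y w ≡ true →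
    ∃[ u ] Path (op G) false y false u L × adj G u y ≡ true
  op-near-cycle (_ , end , _)       yw = ⊥-elim (adj⇒≢ G yw refl)
  op-near-cycle (_ , step e W , σ) yw = _ , permute σ (op-path (yw ◂⁺ rev ⌊ W ⌋)) , e

  -- The cycle is read from `y` the other way round, `y → w … a″ → b ← a → b′ … u`, so that `b`
  -- becomes the source of the pair once arcs are reversed. If `b` is `w` then `a″` is `y`; if `b′`
  -- is `y` then `u` is `a`.
  op-split : ∀ {y w a b L} → Split G y w a b L → adj G y w ≡ true →
    ∃[ u ] Split (op G) y u b a L
  op-split {y} {w} {a} {b} S yw with before-op S.before S.back | after-op S.after
    where
    module S = Split S
    before-op : ∀ {b′ l} → Path G false y false b′ l → adj G a b′ ≡ true →
      ∃[ u ] ∃[ k ] Path G true a true u (a ∷ k) × l ↭ y ∷ k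
    before-op (_ , end , σ)      ab′ = _ , _ , ⌊ end ⌋ , ↭-sym σ
    before-op (_ , step e W , σ) ab′ = _ , _ , ab′ ◂⁺ rev ⌊ W ⌋ , ↭-sym σ
    after-op : ∀ {l} → Path G false b false w l →
      ∃[ a″ ] ∃[ k ] Path G true y true a″ (y ∷ k) × adj G a″ b ≡ true × l ↭ b ∷ k
    after-op (_ , end , σ)      = _ , _ , ⌊ end ⌋ , yw , ↭-sym σ
    after-op (_ , step e W , σ) = _ , _ , yw ◂⁺ rev ⌊ W ⌋ , e , ↭-sym σ
  ... | u , k₁ , Q₁ , σ₁ | a″ , k₂ , Q₂ , a″b , σ₂ = u , record
    { before = op-path Q₂ ; back = a″b ; forth = Split.forth S ; after = op-path Q₁
    ; parts = ↭-trans (Split.parts S) (↭-trans (++⁺ σ₁ (prep a σ₂)) (σ k₁ k₂)) }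
    where
    open Rearrange {Fin n}
    σ : ∀ k₁ k₂ → y ∷ k₁ ++ a ∷ b ∷ k₂ ↭ y ∷ k₂ ++ b ∷ a ∷ k₁
    σ k₁ k₂ = solve 5 (λ y k₁ a b k₂ → y ⊕ (k₁ ⊕ (a ⊕ (b ⊕ k₂))) ⊜ y ⊕ (k₂ ⊕ (b ⊕ (a ⊕ k₁))))
      ↭-refl [ y ] k₁ [ a ] [ b ] k₂

  last∈ : ∀ {s v r w l} → Walk G s v r w l → w ∈ l
  last∈ end        = here refl
  last∈ (step _ W) = there (last∈ W)

module Extensions {G : OrientedGraph n} {L : List (Fin n)} (u : Unique L)
                  (none : NoOddPath G (2 + length L)) where
  open Rearrange {Fin n}

  -- Otherwise `q ← x → y … w` is an odd path with two more vertices.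
  out-closed : ∀ {y w x q} → Path G false y false w L → adj G x y ≡ true → x ∉ L →
    adj G x q ≡ true → q ∈ L
  out-closed P xy x∉ xq = ∈-stable λ q∉ → none (xq ◂⁻ xy ◂⁺ P)
    (Unique-∷ (∉-∷ (λ q≡x → adj⇒≢ G xq (sym q≡x)) q∉) (Unique-∷ x∉ u)) refl

  private
    contradict : ∀ {x x′ s v w K} → x ≢ x′ → x ∉ L → x′ ∉ L → Path G s v s w K →
      K ↭ x ∷ x′ ∷ L → ⊥
    contradict x≢x′ x∉ x′∉ P σ =
      none (permute σ P) (Unique-∷ (∉-∷ x≢x′ x∉) (Unique-∷ x′∉ u)) refl

  -- b′ … y ← x′ → a ← x → b … w
  in-in : ∀ {y w a b x x′} → Split G y w a b L → x ≢ x′ → x ∉ L → x′ ∉ L →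
    adj G x a ≡ true → adj G x b ≡ true → adj G x′ y ≡ true → adj G x′ a ≡ true → ⊥
  in-in {a = a} {x = x} {x′} S x≢x′ x∉ x′∉ xa xb x′y x′a =
    contradict x≢x′ x∉ x′∉ (rev before ⁻◂⟨ x′y ⟩ x′a ◂⁺ xa ◂⁻ xb ◂⁺ after)
      (↭-trans (σ l₁ l₂) (prep x (prep x′ (↭-sym parts))))
    where
    open Split S
    σ : ∀ l k → l ++ x′ ∷ a ∷ x ∷ k ↭ x ∷ x′ ∷ l ++ a ∷ k
    σ l k = solve 5 (λ l x′ a x k → l ⊕ (x′ ⊕ (a ⊕ (x ⊕ k))) ⊜ x ⊕ (x′ ⊕ (l ⊕ (a ⊕ k))))
      ↭-refl l [ x′ ] [ a ] [ x ] k

  -- z ← a → b′ … y ← x → b … w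
  in-out : ∀ {y w a b x z} → Split G y w a b L → x ∉ L → z ∉ L →
    adj G x y ≡ true → adj G y z ≡ true → adj G x b ≡ true → adj G a z ≡ true → ⊥
  in-out {a = a} {x = x} {z} S x∉ z∉ xy yz xb az =
    contradict (λ { refl → adj-asym G xy yz }) x∉ z∉
      (az ◂⁻ back ◂⁺ rev before ⁻◂⟨ xy ⟩ xb ◂⁺ after)
      (↭-trans (σ l₁ l₂) (prep x (prep z (↭-sym parts))))
    where
    open Split S
    σ : ∀ l k → z ∷ a ∷ l ++ x ∷ k ↭ x ∷ z ∷ l ++ a ∷ k
    σ l k = solve 5 (λ l z a x k → z ⊕ (a ⊕ (l ⊕ (x ⊕ k))) ⊜ x ⊕ (z ⊕ (l ⊕ (a ⊕ k))))
      ↭-refl l [ z ] [ a ] [ x ] k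

  -- x′ → y … w ← x
  in-last : ∀ {y w x x′} → Path G false y false w L → x ≢ x′ → x ∉ L → x′ ∉ L →
    adj G x′ y ≡ true → adj G x w ≡ true → ⊥
  in-last {x = x} {x′} P x≢x′ x∉ x′∉ x′y xw =
    contradict x≢x′ x∉ x′∉ (x′y ◂⁺ P ⁻◂⟨ xw ⟩ ⌊ end ⌋) (++-comm (x′ ∷ L) [ x ])

  -- x → y … b′ ← a → z ← w
  out-last : ∀ {y w a x z} → Split G y w a w L → x ∉ L → z ∉ L →
    adj G x y ≡ true → adj G y z ≡ true → adj G a z ≡ true → adj G w z ≡ true → ⊥
  out-last {w = w} {a} {x} {z} S x∉ z∉ xy yz az wz with Split.after S
  ... | _ , end , σ′ = contradict (λ { refl → adj-asym G xy yz }) x∉ z∉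
      (xy ◂⁺ before ⁻◂⟨ back ⟩ az ◂⁺ wz ◂⁻ ⌊ end ⌋)
      (↭-trans (σ l₁) (prep x (prep z (↭-sym (↭-trans parts (++⁺ ↭-refl (prep a (↭-sym σ′))))))))
    where
    open Split S
    σ : ∀ l → x ∷ l ++ a ∷ z ∷ w ∷ [] ↭ x ∷ z ∷ l ++ a ∷ w ∷ []
    σ l = solve 5 (λ l x a z w → x ⊕ (l ⊕ (a ⊕ (z ⊕ w))) ⊜ x ⊕ (z ⊕ (l ⊕ (a ⊕ w))))
      ↭-refl l [ x ] [ a ] [ z ] [ w ]
  -- A final part from `w` to `w` with at least one arc would repeat `w`.
  ... | _ , step {l = l} e W , σ′ with Unique-resp-↭
      (↭-trans (Split.parts S) (↭-trans (++⁺ (↭-refl {x = Split.l₁ S}) (prep a (↭-sym σ′)))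
        (σ (Split.l₁ S) l))) u
    where
    σ : ∀ k l → k ++ a ∷ w ∷ l ↭ w ∷ l ++ a ∷ k
    σ k l = solve 4 (λ k a w l → k ⊕ (a ⊕ (w ⊕ l)) ⊜ w ⊕ (l ⊕ (a ⊕ k))) ↭-refl k [ a ] [ w ] l
  ... | w∉ ∷ _ = All.lookup w∉ (∈-++⁺ˡ (last∈ W)) refl

-- Double counting outside neighbours against pairs

-- Vertices outside L with an arc to y; those with an arc from y are  into (op G) L y.
into : OrientedGraph n → List (Fin n) → Fin n → Fin n → Bool
into G L y v = not (does (v ∈? L)) ∧ adj G v y

into-sound : (G : OrientedGraph n) → ∀ L y v → into G L y v ≡ true → v ∉ L × adj G v y ≡ true
into-sound G L y v e with v ∈? L
... | no v∉ = v∉ , e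

-- `y` has an in-neighbour on the path and the out-neighbour `w`, hence at least `2 * d` neighbours,
-- of which fewer than `length L` lie in `L`.
outside-degree : (G : OrientedGraph n) → PseudoSemidegreeCond G d → ∀ {y w L} →
  Path G false y false w L → adj G y w ≡ true →
  2 * d < ∑ (λ v → ⟦ into G L y v ⟧ + ⟦ into (op G) L y v ⟧) (allFin n) + length L
outside-degree {n = n} {d = d} G cond (_ , end , _) yw = ⊥-elim (adj⇒≢ G yw refl)
outside-degree {n = n} {d = d} G cond {y} {w} {L} P@(_ , step e W , _) yw = begin-strict
  2 * d                     ≡⟨ cong (d +_) (+-identityʳ d) ⟩
  d + d                     ≤⟨ +-mono-≤ (≤indeg G cond e) (≤outdeg G cond yw) ⟩
  indeg G y + outdeg G y    ≡⟨ ∑-+ (λ v → ⟦ adj G v y ⟧) _ (allFin n) ⟨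
  ∑ N (allFin n)            ≤⟨ ∑-mono N (λ v → out v + inside v) pointwise (allFin n) ⟩
  ∑ (λ v → out v + inside v) (allFin n)
                            ≡⟨ ∑-+ out inside (allFin n) ⟩
  ∑ out (allFin n) + ∑ inside (allFin n)
                            ≤⟨ +-monoʳ-≤ (∑ out (allFin n)) (∑-cover inside (allFin⁺ n) inside-cases) ⟩
  ∑ out (allFin n) + ∑ inside L
                            ≤⟨ +-monoʳ-≤ (∑ out (allFin n)) (∑-mono inside N inside≤ L) ⟩
  ∑ out (allFin n) + ∑ N L  <⟨ +-monoʳ-< (∑ out (allFin n)) (neighbours<length G (first∈ P)) ⟩
  ∑ out (allFin n) + length L ∎
  where
  open ≤-Reasoning
  N out inside : Fin n → ℕ
  N v      = ⟦ adj G v y ⟧ + ⟦ adj G y v ⟧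
  out v    = ⟦ into G L y v ⟧ + ⟦ into (op G) L y v ⟧
  inside v = if does (v ∈? L) then N v else 0
  pointwise : ∀ v → N v ≤ out v + inside v
  pointwise v with v ∈? L
  ... | yes _ = ≤-refl
  ... | no _  = m≤m+n _ _
  inside≤ : ∀ v → inside v ≤ N v
  inside≤ v with v ∈? L
  ... | yes _ = ≤-refl
  ... | no _  = z≤n
  inside-cases : ∀ v → inside v ≡ 0 ⊎ v ∈ L
  inside-cases v with v ∈? L
  ... | yes v∈ = inj₂ v∈
  ... | no _   = inj₁ refl

∧-true : ∀ p q → p ∧ q ≡ true → p ≡ true × q ≡ true
∧-true true q e = refl , e

∨-true : ∀ p q → p ∨ q ≡ true → p ≡ true ⊎ q ≡ true
∨-true true  q e = inj₁ refl
∨-true false q e = inj₂ e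

-- Counts outside in-neighbours and out-neighbours of `y` by a single sum; for a vertex of neither
-- kind the left side vanishes.
∑⟦⟧-either : ∀ c p q (f g : A → Bool) xs → (p ≡ true → q ≡ true → ⊥) →
  (p ≡ true → c ≤ ∑ (λ x → ⟦ f x ⟧) xs) → (q ≡ true → c ≤ ∑ (λ x → ⟦ g x ⟧) xs) →
  c * (⟦ p ⟧ + ⟦ q ⟧) ≤ ∑ (λ x → ⟦ (p ∧ f x) ∨ (q ∧ g x) ⟧) xs
∑⟦⟧-either c true  true  f g xs h _ _ = ⊥-elim (h refl refl)
∑⟦⟧-either c true  false f g xs _ h _ = begin
  c * 1                            ≡⟨ *-identityʳ c ⟩
  c                                ≤⟨ h refl ⟩
  ∑ (λ x → ⟦ f x ⟧) xs             ≤⟨ ∑-mono _ _ (λ x → ⟦⟧≤∨ (f x)) xs ⟩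
  ∑ (λ x → ⟦ f x ∨ false ⟧) xs     ∎
  where
  open ≤-Reasoning
  ⟦⟧≤∨ : ∀ b → ⟦ b ⟧ ≤ ⟦ b ∨ false ⟧
  ⟦⟧≤∨ true  = ≤-refl
  ⟦⟧≤∨ false = ≤-refl
∑⟦⟧-either c false true  f g xs _ _ h = ≤-trans (≤-reflexive (*-identityʳ c)) (h refl)
∑⟦⟧-either c false false f g xs _ _ _ = ≤-trans (≤-reflexive (*-zeroʳ c)) z≤n

-- Of d neighbours in y ∷ flat ps, at most 1 + length ps are accounted for by y and by
-- one vertex of each pair.
full-pairs : (f : A → Bool) → ∀ y ps → suc (length ps) + c ≤ ∑ (λ v → ⟦ f v ⟧) (y ∷ flat ps) →
  c ≤ ∑ (λ (a , b) → ⟦ f a ∧ f b ⟧) ps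
full-pairs {c = c} f y ps h = +-cancelˡ-≤ (suc (length ps)) _ _ (begin
  suc (length ps) + c                              ≤⟨ h ⟩
  ⟦ f y ⟧ + ∑ (λ v → ⟦ f v ⟧) (flat ps)            ≤⟨ +-mono-≤ (⟦⟧≤1 (f y)) (bound ps) ⟩
  suc (length ps) + ∑ (λ (a , b) → ⟦ f a ∧ f b ⟧) ps ∎)
  where
  open ≤-Reasoning
  pair : ∀ p q → ⟦ p ⟧ + ⟦ q ⟧ ≤ 1 + ⟦ p ∧ q ⟧
  pair true  q = ≤-refl
  pair false q = ⟦⟧≤1 q
  regroup : ∀ p q r → (1 + p) + (q + r) ≡ (1 + q) + (p + r)
  regroup = solve-∀
  bound : ∀ ps → ∑ (λ v → ⟦ f v ⟧) (flat ps) ≤ length ps + ∑ (λ (a , b) → ⟦ f a ∧ f b ⟧) ps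
  bound []             = z≤n
  bound ((a , b) ∷ ps) = begin
    ⟦ f a ⟧ + (⟦ f b ⟧ + ∑ (λ v → ⟦ f v ⟧) (flat ps)) ≡⟨ +-assoc ⟦ f a ⟧ ⟦ f b ⟧ _ ⟨
    (⟦ f a ⟧ + ⟦ f b ⟧) + ∑ (λ v → ⟦ f v ⟧) (flat ps) ≤⟨ +-mono-≤ (pair (f a) (f b)) (bound ps) ⟩
    (1 + ⟦ f a ∧ f b ⟧) + (length ps + ∑ (λ (a , b) → ⟦ f a ∧ f b ⟧) ps)
                                                      ≡⟨ regroup ⟦ f a ∧ f b ⟧ (length ps) _ ⟩
    suc (length ps) + (⟦ f a ∧ f b ⟧ + ∑ (λ (a , b) → ⟦ f a ∧ f b ⟧) ps) ∎

2*-cancel-suc : ∀ {k l} → suc (2 * k) ≡ suc (2 * l) → k ≡ l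
2*-cancel-suc e = *-cancelˡ-≡ _ _ 2 (suc-injective e)

-- Double counting: each of at least `2 + 2 * c` outside neighbours of `y` serves at least `c` of
-- the `t` pairs, each pair is served at most once, and the last one never. Here `2 * t + 1` is the
-- size of the near-cycle.
two-into : (G : OrientedGraph n) → PseudoSemidegreeCond G d → d ≡ suc t + c →
  t ≤ c * (2 + 2 * c) → NoOddPath G (3 + 2 * t) → ∀ {y w L} →
  Path G false y false w L → adj G y w ≡ true → Unique L → length L ≡ suc (2 * t) →
  ∀ {x₁ x₂} → x₁ ≢ x₂ → x₁ ∉ L → x₂ ∉ L → adj G x₁ y ≡ true → adj G x₂ y ≡ true → ⊥
two-into {n = n} {d = d} {t = t} {c = c} G cond refl t≤ none {y} {w} {L}
  P@(_ , W , perm) yw u len {x₁} {x₂} x₁≢x₂ x₁∉ x₂∉ x₁y x₂y with toZigzag W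
... | ps , Z , refl = <-irrefl refl (begin-strict
  c * (2 + 2 * c)                                        ≤⟨ *-monoʳ-≤ c outside≥ ⟩
  c * ∑ (λ v → ⟦ X v ⟧ + ⟦ Y v ⟧) (allFin n)             ≡⟨ ∑-* c _ (allFin n) ⟨
  ∑ (λ v → c * (⟦ X v ⟧ + ⟦ Y v ⟧)) (allFin n)           ≤⟨ ∑-mono _ _ many-pairs (allFin n) ⟩
  ∑ (λ v → ∑ (λ p → ⟦ serves p v ⟧) ps) (allFin n)       ≡⟨ ∑-swap (λ v p → ⟦ serves p v ⟧) (allFin n) ps ⟩
  ∑ (λ p → ∑ (λ v → ⟦ serves p v ⟧) (allFin n)) ps       <⟨ few-servings ⟩
  length ps                                              ≡⟨ length-ps ⟩
  t                                                      ≤⟨ t≤ ⟩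
  c * (2 + 2 * c)                                        ∎)
  where
  open ≤-Reasoning
  X Y : Fin n → Bool
  X = into G L y
  Y = into (op G) L y
  serves : Fin n × Fin n → Fin n → Bool
  serves (a , b) v = (X v ∧ (adj G v a ∧ adj G v b)) ∨ (Y v ∧ (adj G a v ∧ adj G b v))

  length-ps : length ps ≡ t
  length-ps = 2*-cancel-suc (trans (cong suc (sym (length-flat ps))) (trans (↭-length perm) len))

  none′ : NoOddPath G (2 + length L)
  none′ Q v e = none Q v (trans e (cong (2 +_) len))
  module E = Extensions {G = G} u none′
  module Eᵒᵖ = Extensions {G = op G} u (NoOddPath-op {G = G} none′)

  outside≥ : 2 + 2 * c ≤ ∑ (λ v → ⟦ X v ⟧ + ⟦ Y v ⟧) (allFin n)
  -- More than `2 * d - (2 * t + 1)`, which is `2 * c + 1`, neighbours lie outside; strictness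
  -- supplies the last one.
  outside≥ = +-cancelʳ-≤ (suc (2 * t)) _ _ (begin
    2 + 2 * c + suc (2 * t)        ≡⟨ regroup t c ⟩
    suc (2 * (suc t + c))          ≤⟨ outside-degree G cond P yw ⟩
    ∑ (λ v → ⟦ X v ⟧ + ⟦ Y v ⟧) (allFin n) + length L ≡⟨ cong (∑ (λ v → ⟦ X v ⟧ + ⟦ Y v ⟧) (allFin n) +_) len ⟩
    ∑ (λ v → ⟦ X v ⟧ + ⟦ Y v ⟧) (allFin n) + suc (2 * t) ∎)
    where
    regroup : ∀ t c → 2 + 2 * c + suc (2 * t) ≡ suc (2 * (suc t + c))
    regroup = solve-∀

  pairs : (f : Fin n → Bool) → suc t + c ≤ ∑ (λ v → ⟦ f v ⟧) L →
    c ≤ ∑ (λ (a , b) → ⟦ f a ∧ f b ⟧) ps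
  pairs f h = full-pairs f y ps (begin
    suc (length ps) + c               ≡⟨ cong (λ k → suc k + c) length-ps ⟩
    suc t + c                         ≤⟨ h ⟩
    ∑ (λ v → ⟦ f v ⟧) L               ≡⟨ ∑-↭ (λ v → ⟦ f v ⟧) perm ⟨
    ∑ (λ v → ⟦ f v ⟧) (y ∷ flat ps)   ∎)

  many-pairs : ∀ v → c * (⟦ X v ⟧ + ⟦ Y v ⟧) ≤ ∑ (λ p → ⟦ serves p v ⟧) ps
  many-pairs v = ∑⟦⟧-either c (X v) (Y v)
    (λ (a , b) → adj G v a ∧ adj G v b) (λ (a , b) → adj G a v ∧ adj G b v) ps
    (λ Xv Yv → adj-asym G (proj₂ (into-sound G L y v Xv)) (proj₂ (into-sound (op G) L y v Yv)))
    from-in from-out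
    where
    from-in : X v ≡ true → c ≤ ∑ (λ (a , b) → ⟦ adj G v a ∧ adj G v b ⟧) ps
    from-in Xv with into-sound G L y v Xv
    ... | v∉ , vy = pairs (adj G v)
      (≤-trans (≤outdeg G cond vy) (outdeg-inside G λ q vq → E.out-closed P vy v∉ vq))
    from-out : Y v ≡ true → c ≤ ∑ (λ (a , b) → ⟦ adj G a v ∧ adj G b v ⟧) ps
    from-out Yv with into-sound (op G) L y v Yv
    ... | v∉ , yv = pairs (λ a → adj G a v)
      (≤-trans (≤indeg G cond yv) (outdeg-inside (op G) λ q qv →
        Eᵒᵖ.out-closed (proj₁ (proj₂ (op-near-cycle P yw))) yv v∉ qv))

  data Serves (a b v : Fin n) : Set where
    sends    : v ∉ L → adj G v y ≡ true → adj G v a ≡ true → adj G v b ≡ true → Serves a b v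
    receives : v ∉ L → adj G y v ≡ true → adj G a v ≡ true → adj G b v ≡ true → Serves a b v

  serves-sound : ∀ {a b} v → serves (a , b) v ≡ true → Serves a b v
  serves-sound {a} {b} v e with ∨-true (X v ∧ (adj G v a ∧ adj G v b)) _ e
  ... | inj₁ e₁ with ∧-true (X v) _ e₁
  ... | Xv , e₂ with into-sound G L y v Xv | ∧-true (adj G v a) _ e₂
  ... | v∉ , vy | va , vb = sends v∉ vy va vb
  serves-sound {a} {b} v e | inj₂ e₁ with ∧-true (Y v) _ e₁
  ... | Yv , e₂ with into-sound (op G) L y v Yv | ∧-true (adj G a v) _ e₂
  ... | v∉ , yv | av , bv = receives v∉ yv av bv

  split : ∀ {a b} → (a , b) ∈ ps → Split G y w a b L
  split = split-at ⌊ end ⌋ Z (↭-sym perm)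

  exclusive : ∀ {a b} → Split G y w a b L → ∀ v v′ → v ≢ v′ →
    Serves a b v → Serves a b v′ → ⊥
  exclusive S v v′ v≢v′ (sends v∉ vy va vb) (sends v′∉ v′y v′a v′b) =
    E.in-in S v≢v′ v∉ v′∉ va vb v′y v′a
  exclusive S v v′ v≢v′ (sends v∉ vy va vb) (receives v′∉ yv′ av′ bv′) =
    E.in-out S v∉ v′∉ vy yv′ vb av′
  exclusive S v v′ v≢v′ (receives v∉ yv av bv) (sends v′∉ v′y v′a v′b) =
    E.in-out S v′∉ v∉ v′y yv v′b av
  -- Two receivers are two senders in the reversed graph, where the pair is `(b , a)`.
  exclusive S v v′ v≢v′ (receives v∉ yv av bv) (receives v′∉ yv′ av′ bv′) =
    Eᵒᵖ.in-in (proj₂ (op-split S yw)) v≢v′ v∉ v′∉ bv av yv′ bv′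

  last-unserved : ∀ {a} → Split G y w a w L → ∀ v → Serves a w v → ⊥
  -- An in-neighbour of `y` other than `v` is required; one of `x₁`, `x₂` always qualifies.
  last-unserved S v (sends v∉ vy va vw) with v Fin.≟ x₁
  ... | no v≢x₁  = E.in-last P v≢x₁ v∉ x₁∉ x₁y vw
  ... | yes refl = E.in-last P x₁≢x₂ v∉ x₂∉ x₂y vw
  last-unserved S v (receives v∉ yv av wv) = E.out-last S x₁∉ v∉ x₁y yv av wv

  last : ∀ {ps} → Zigzag G y w ps → ∃[ a ] (a , w) ∈ ps
  last done          = ⊥-elim (adj⇒≢ G yw refl)
  last (zig _ f Z′) with last-pair f Z′
  ... | a , p , _ = a , p

  few-servings : ∑ (λ p → ∑ (λ v → ⟦ serves p v ⟧) (allFin n)) ps < length ps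
  few-servings = ∑<length _
    (λ {p} p∈ → ∑⟦⟧≤1 (serves p) (allFin⁺ n) λ v v′ v≢v′ e e′ →
      exclusive (split p∈) v v′ v≢v′ (serves-sound v e) (serves-sound v′ e′))
    (proj₂ (last Z))
    (∑⟦⟧≡0 (serves (proj₁ (last Z) , w))
      (λ v e → last-unserved (split (proj₂ (last Z))) v (serves-sound v e)) (allFin n))

-- At least four neighbours of `y` lie outside, so two are of the same kind. Two out-neighbours are
-- treated in the reversed graph, where `y` again ends a near-cycle on the same vertices.
no-near-cycle : (G : OrientedGraph n) → PseudoSemidegreeCond G d → d ≡ suc t + c →
  1 ≤ c → t ≤ c * (2 + 2 * c) → NoOddPath G (3 + 2 * t) → NoNearCycle G (suc (2 * t))
no-near-cycle {n = n} {t = t} {c = c} G cond refl 1≤c t≤ none {y} {w} {L} P yw u len =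
  <-irrefl refl (begin-strict
    2 * (suc t + c)            <⟨ outside-degree G cond P yw ⟩
    ∑ (λ v → ⟦ into G L y v ⟧ + ⟦ into (op G) L y v ⟧) (allFin n) + length L
                               ≡⟨ cong₂ _+_ (∑-+ (λ v → ⟦ into G L y v ⟧) _ (allFin n)) len ⟩
    (∑ (λ v → ⟦ into G L y v ⟧) (allFin n) + ∑ (λ v → ⟦ into (op G) L y v ⟧) (allFin n))
      + suc (2 * t)            ≤⟨ +-monoˡ-≤ (suc (2 * t)) (+-mono-≤ few-in few-out) ⟩
    3 + 2 * t                  ≤⟨ n≤1+n _ ⟩
    4 + 2 * t                  ≡⟨ regroup t ⟩
    2 * (suc t + 1)            ≤⟨ *-monoʳ-≤ 2 (+-monoʳ-≤ (suc t) 1≤c) ⟩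
    2 * (suc t + c)            ∎)
  where
  open ≤-Reasoning
  regroup : ∀ t → 4 + 2 * t ≡ 2 * (suc t + 1)
  regroup = solve-∀
  few-in : ∑ (λ v → ⟦ into G L y v ⟧) (allFin n) ≤ 1
  few-in = ∑⟦⟧≤1 (into G L y) (allFin⁺ n) λ v v′ v≢v′ e e′ →
    let v∉ , vy = into-sound G L y v e ; v′∉ , v′y = into-sound G L y v′ e′
    in two-into G cond refl t≤ none P yw u len v≢v′ v∉ v′∉ vy v′y
  few-out : ∑ (λ v → ⟦ into (op G) L y v ⟧) (allFin n) ≤ 1
  few-out = ∑⟦⟧≤1 (into (op G) L y) (allFin⁺ n) λ v v′ v≢v′ e e′ →
    let v∉ , yv = into-sound (op G) L y v e ; v′∉ , yv′ = into-sound (op G) L y v′ e′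
        _ , Q , uy = op-near-cycle P yw
    in two-into (op G) (Condition-op {G = G} cond) refl t≤ (NoOddPath-op {G = G} none)
         Q uy u len v≢v′ v∉ v′∉ yv yv′

-- Descent to a single arc

edge⇒even-path : (G : OrientedGraph n) → HasEdge G → NoEvenPath G 2 → ⊥
edge⇒even-path G (u , v , uv) none =
  none (uv ◂⁺ ⌊ end ⌋) (Unique-∷ (λ { (here u≡v) → adj⇒≢ G uv u≡v }) ([] ∷ [])) refl

-- Descent on `t` with `t + c` fixed: if no even path has a given size, none is two vertices
-- shorter, until a single arc is excluded. The inequalities persist because `t` drops while `c`
-- grows.
even-path-exists : (G : OrientedGraph n) → PseudoSemidegreeCond G d → HasEdge G → ∀ t c →
  d ≡ t + c → 1 ≤ c → t ≤ suc (c * (2 + 2 * c)) → NoEvenPath G (2 + 2 * t) → ⊥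
even-path-exists G cond edge zero    c d≡ 1≤c t≤ none = edge⇒even-path G edge none
even-path-exists {d = d} G cond edge (suc t) c d≡ 1≤c t≤ none =
  even-path-exists G cond edge t (suc c) (trans d≡ (sym (+-suc t c))) (s≤s z≤n)
    (≤-trans (≤-pred t≤) (m≤n⇒m≤1+n (*-mono-≤ (n≤1+n c) (+-monoʳ-≤ 2 (*-monoʳ-≤ 2 (n≤1+n c))))))
    (subst (NoEvenPath G) (*-suc 2 t)
      (no-even-path G cond t<d odd (no-near-cycle G cond d≡ 1≤c (≤-pred t≤) odd)))
  where
  t<d : suc t < d
  t<d = ≤-trans (≤-reflexive (sym (+-comm (suc t) 1)))
          (≤-trans (+-monoʳ-≤ (suc t) 1≤c) (≤-reflexive (sym d≡)))
  odd : NoOddPath G (3 + 2 * t)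
  odd {s} = subst (NoOddPath G) (cong suc (*-suc 2 t)) (no-odd-path G cond (s≤s z≤n) t<d none) {s}

-- From walks to embeddings

lookup-injective : {A : Set} {xs : List A} → Unique xs → ∀ {i j} → lookup xs i ≡ lookup xs j → i ≡ j
lookup-injective (x∉ ∷ u) {fzero}  {fzero}  eq = refl
lookup-injective (x∉ ∷ u) {fzero}  {fsuc j} eq = ⊥-elim (All.lookup x∉ (∈-lookup j) eq)
lookup-injective (x∉ ∷ u) {fsuc i} {fzero}  eq = ⊥-elim (All.lookup x∉ (∈-lookup i) (sym eq))
lookup-injective (x∉ ∷ u) {fsuc i} {fsuc j} eq = cong fsuc (lookup-injective u eq)

-- An antidirected orientation is determined by its first arc, so it agrees with the alternating
-- signs of the walk. Only the first `suc k` vertices of the walk are used.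
walk-edges : {G : OrientedGraph n} → ∀ {k s v r w l} (dir : PathOrientation k) → IsAntipath dir →
  (∀ i → toℕ i ≡ 0 → dir i ≡ s) → Walk G s v r w l → (k<l : suc k ≤ length l) →
  ∀ i → EdgeIn G dir (λ j → lookup l (inject≤ j k<l)) i
walk-edges dir anti start end (s≤s ()) fzero
-- Splitting the rest of the walk only exposes its first vertex to `lookup`.
walk-edges {s = true} dir anti start (step e end) k<l fzero rewrite start fzero refl = e
walk-edges {s = true} dir anti start (step e (step _ _)) k<l fzero rewrite start fzero refl = e
walk-edges {s = false} dir anti start (step e end) k<l fzero rewrite start fzero refl = e
walk-edges {s = false} dir anti start (step e (step _ _)) k<l fzero rewrite start fzero refl = e
walk-edges dir anti start end (s≤s ()) (fsuc i)
walk-edges {s = s} dir anti start (step e W) (s≤s k<l) (fsuc i) =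
  walk-edges (λ j → dir (fsuc j)) (λ i j eq → anti (fsuc i) (fsuc j) (cong suc eq)) start′ W k<l i
  where
  start′ : ∀ j → toℕ j ≡ 0 → dir (fsuc j) ≡ not s
  start′ j j≡0 = trans (¬-not (λ eq → anti fzero (fsuc j) (cong suc j≡0) (sym eq)))
                       (cong not (start fzero refl))

path⇒contains : {G : OrientedGraph n} → ∀ {k s v r w L} (dir : PathOrientation k) → IsAntipath dir →
  (∀ i → toℕ i ≡ 0 → dir i ≡ s) → Path G s v r w L → Unique L → suc k ≤ length L →
  ContainsPath G dir
path⇒contains dir anti start (l , W , σ) u k<L = _ ,
  (λ eq → Fin.inject≤-injective k<l k<l _ _ (lookup-injective (Unique-resp-↭ (↭-sym σ) u) eq)) ,
  walk-edges dir anti start W k<l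
  where
  k<l = ≤-trans k<L (≤-reflexive (sym (↭-length σ)))

-- With one source end and one sink end, an even path can be read so as to start in either
-- direction; this yields both antipaths when `k` is even.
even-path⇒contains : {G : OrientedGraph n} → ∀ {k v w L} (dir : PathOrientation k) →
  IsAntipath dir → Path G true v false w L → Unique L → suc k ≤ length L → ContainsPath G dir
even-path⇒contains {k = zero}  dir anti P u k<L = path⇒contains dir anti (λ ()) P u k<L
even-path⇒contains {k = suc k} dir anti P u k<L with dir fzero in eq
... | true  = path⇒contains dir anti (λ { fzero _ → eq }) P u k<L
... | false = path⇒contains dir anti (λ { fzero _ → eq }) (rev P) u k<L

-- Makes containment decidable, so that arguing by contradiction is constructive. A function rebuilt
-- from its values agrees with the original only pointwise, hence the condition on `P`.
any-function? : ∀ m {P : (Fin m → Fin n) → Set} → (∀ {f g} → (∀ i → f i ≡ g i) → P f → P g) →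
  (∀ f → Dec (P f)) → Dec (∃ P)
any-function? zero resp P? =
  map′ (λ p → _ , p) (λ (f , p) → resp (λ ()) p) (P? (λ ()))
any-function? {n} (suc m) resp P? =
  map′ (λ (x , f , p) → cons x f , p)
       (λ (f , p) → f fzero , (λ i → f (fsuc i)) , resp (λ { fzero → refl ; (fsuc i) → refl }) p)
       (Fin.any? λ x → any-function? m (λ f≗g → resp λ { fzero → refl ; (fsuc i) → f≗g i })
                                        (λ f → P? (cons x f)))
  where
  cons : Fin n → (Fin m → Fin n) → Fin (suc m) → Fin n
  cons x f fzero    = x
  cons x f (fsuc i) = f i

contains? : (G : OrientedGraph n) → ∀ {k} (dir : PathOrientation k) → Dec (ContainsPath G dir)
contains? {n = n} G {k} dir = any-function? (suc k) respects
  (λ f → injective? f ×-dec Fin.all? (edge? f))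
  where
  edge-resp : ∀ {f g : Fin (suc k) → Fin n} → (∀ i → f i ≡ g i) → ∀ i →
    EdgeIn G dir f i → EdgeIn G dir g i
  edge-resp f≗g i e with dir i
  ... | true  = trans (sym (cong₂ (adj G) (f≗g _) (f≗g _))) e
  ... | false = trans (sym (cong₂ (adj G) (f≗g _) (f≗g _))) e
  respects : ∀ {f g : Fin (suc k) → Fin n} → (∀ i → f i ≡ g i) →
    Injective _≡_ _≡_ f × (∀ i → EdgeIn G dir f i) →
    Injective _≡_ _≡_ g × (∀ i → EdgeIn G dir g i)
  respects f≗g (inj , es) =
    (λ eq → inj (trans (f≗g _) (trans eq (sym (f≗g _))))) , λ i → edge-resp f≗g i (es i)
  injective? : (f : Fin (suc k) → Fin n) → Dec (Injective _≡_ _≡_ f)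
  injective? f = map′ (λ h {x} {y} → h x y) (λ h x y → h {x} {y})
    (Fin.all? λ x → Fin.all? λ y → (f x Fin.≟ f y) →-dec (x Fin.≟ y))
  edge? : (f : Fin (suc k) → Fin n) → ∀ i → Dec (EdgeIn G dir f i)
  edge? f i with dir i
  ... | true  = _ ≟ᵇ true
  ... | false = _ ≟ᵇ true

-- The numerical hypothesis

halve : ∀ k → ∃[ t ] (k ≡ 2 * t ⊎ k ≡ suc (2 * t))
halve zero = 0 , inj₁ refl
halve (suc k) with halve k
... | t , inj₁ refl = t , inj₂ refl
... | t , inj₂ refl = suc t , inj₁ (sym (*-suc 2 t))

<+∸ : ∀ m {k l} → m ∸ k < l → m < k + l
<+∸ m {k} {l} h = ≤-trans (s≤s (m≤n+m∸n m k)) (≤-trans (≤-reflexive (sym (+-suc k (m ∸ k)))) (+-monoʳ-≤ k h))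

-- `t` is half of `k` rounded down and `c` is `d - t`, so an even path on `2 + 2 * t` vertices has
-- at least `k + 1` of them. For even `k` the square bounded below is that of `2 * c + 1`, and the
-- bound on `t` is exactly the hypothesis.
surplus : ∀ {k d} → 4 ≤ k → AboveBound k d →
  ∃[ t ] ∃[ c ] d ≡ t + c × 1 ≤ c × t ≤ suc (c * (2 + 2 * c)) × k ≤ suc (2 * t)
surplus {k} {d} 4≤k (k<2d+1 , k∸3<) with halve k
... | t , inj₁ refl = t , d ∸ t , sym d≡ , positive (d ∸ t) t≤ , t≤ , n≤1+n _
  where
  open ≤-Reasoning
  d≡ : t + (d ∸ t) ≡ d
  d≡ = m+[n∸m]≡n {t} (*-cancelˡ-≤ 2 (≤-pred (≤-trans k<2d+1 (≤-reflexive (+-comm (2 * d) 1)))))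
  excess : ∀ c → 2 * (t + c) + 1 ∸ 2 * t ≡ 2 * c + 1
  excess c = trans (cong (_∸ 2 * t) (regroup t c)) (m+n∸n≡m (2 * c + 1) (2 * t))
    where
    regroup : ∀ t c → 2 * (t + c) + 1 ≡ 2 * c + 1 + 2 * t
    regroup = solve-∀
  bound : ∀ c → t + c ≡ d → t ≤ suc (c * (2 + 2 * c))
  bound c refl = ≤-pred (*-cancelˡ-< 2 _ _ (begin-strict
    2 * t                                <⟨ <+∸ (2 * t) {3} k∸3< ⟩
    3 + (2 * (t + c) + 1 ∸ 2 * t) * (2 * (t + c) + 1 ∸ 2 * t)
                                         ≡⟨ cong (λ e → 3 + e * e) (excess c) ⟩
    3 + (2 * c + 1) * (2 * c + 1)        ≡⟨ square c ⟩
    2 * (2 + c * (2 + 2 * c))            ∎))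
    where
    square : ∀ c → 3 + (2 * c + 1) * (2 * c + 1) ≡ 2 * (2 + c * (2 + 2 * c))
    square = solve-∀
  t≤ = bound (d ∸ t) d≡
  positive : ∀ c → t ≤ suc (c * (2 + 2 * c)) → 1 ≤ c
  -- With `c` zero, `t` would be at most 1, against `4 ≤ k`.
  positive zero    t≤1 = ⊥-elim (<-irrefl refl (≤-trans (s≤s (*-monoʳ-≤ 2 t≤1)) (≤-trans (n≤1+n 3) 4≤k)))
  positive (suc c) _   = s≤s z≤n
... | t , inj₂ refl = t , d ∸ t , sym d≡ , m<n⇒0<n∸m t<d , bound (d ∸ t) d≡ , ≤-refl
  where
  open ≤-Reasoning
  t<d : t < d
  t<d = *-cancelˡ-< 2 _ _ (≤-pred (≤-trans k<2d+1 (≤-reflexive (+-comm (2 * d) 1))))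
  d≡ : t + (d ∸ t) ≡ d
  d≡ = m+[n∸m]≡n (<⇒≤ t<d)
  excess : ∀ c → 2 * (t + c) + 1 ∸ suc (2 * t) ≡ 2 * c
  excess c = trans (cong (_∸ suc (2 * t)) (regroup t c)) (m+n∸n≡m (2 * c) (suc (2 * t)))
    where
    regroup : ∀ t c → 2 * (t + c) + 1 ≡ 2 * c + suc (2 * t)
    regroup = solve-∀
  bound : ∀ c → t + c ≡ d → t ≤ suc (c * (2 + 2 * c))
  bound c refl = ≤-pred (*-cancelˡ-< 2 _ _ (begin-strict
    2 * t                                <⟨ n<1+n _ ⟩
    suc (2 * t)                          <⟨ <+∸ (suc (2 * t)) {3} k∸3< ⟩
    3 + (2 * (t + c) + 1 ∸ suc (2 * t)) * (2 * (t + c) + 1 ∸ suc (2 * t))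
                                         ≡⟨ cong (λ e → 3 + e * e) (excess c) ⟩
    -- For odd `k` the square is only that of `2 * c`; the slack `1 + 4 * c` brings it to the form
    -- of the even case.
    3 + (2 * c) * (2 * c)                ≤⟨ m≤m+n _ (1 + 4 * c) ⟩
    3 + (2 * c) * (2 * c) + (1 + 4 * c)  ≡⟨ square c ⟩
    2 * (2 + c * (2 + 2 * c))            ∎))
    where
    square : ∀ c → 3 + (2 * c) * (2 * c) + (1 + 4 * c) ≡ 2 * (2 + c * (2 + 2 * c))
    square = solve-∀

theorem1p3 : (k : ℕ) → 4 ≤ k → (n : ℕ) → (G : OrientedGraph n) →
    (d : ℕ) → AboveBound k d → MinPseudoSemidegree≥ G d →
    (dir : PathOrientation k) → IsAntipath dir → ContainsPath G dir
theorem1p3 k 4≤k n G d above (edge , cond) dir anti with surplus 4≤k above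
... | t , c , d≡ , 1≤c , t≤ , k≤ = decidable-stable (contains? G dir) λ none →
  even-path-exists G cond edge t c d≡ 1≤c t≤ λ P u len →
    none (even-path⇒contains dir anti P u (≤-trans (s≤s k≤) (≤-reflexive (sym len))))
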